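{- Let $G$ be a connected graph with vertices $v_1,\dots,v_n$, and let $k_1,k_2,k_3$ be nonnegative integers with $k_2\neq k_3$. Then \[ \sum_{i=1}^{n} dav(G-v_i,k_1,k_2,k_3)=(n-2-k_1-k_2-k_3)\,dav(G,k_1,k_2,k_3)+(k_1+1)\,dav(G,k_1+1,k_2,k_3)+(k_2+1)\,dav(G,k_1,k_2+1,k_3)+(k_3+1)\,dav(G,k_1,k_2,k_3+1). \]
   Context: All graphs are finite, simple and undirected. $G-v$ denotes the graph obtained from $G$ by deleting vertex $v$ and its incident edges. For a graph $F$ and nonnegative integers $k_1,k_2,k_3$, $dav(F,k_1,k_2,k_3)$ denotes the number of pairs of adjacent vertices $x$ and $y$ in $F$ such that exactly $k_1$ vertices are adjacent to both $x$ and $y$, exactly $k_2$ vertices other than $y$ are adjacent to $x$ but not to $y$, and exactly $k_3$ vertices other than $x$ are adjacent to $y$ but not to $x$. -}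

module Defs where

open import Data.Fin using (Fin; punchIn)
open import Data.Fin.Properties using () renaming (_≟_ to _≟ᶠ_)
open import Data.List using (allFin; cartesianProduct; filter; length)
open import Data.Nat using (ℕ; suc; pred; _≟_)
open import Data.Product using (_×_; _,_)
open import Level using (0ℓ)
open import Relation.Binary using (Rel; Decidable; Symmetric)
open import Relation.Binary.Construct.Closure.ReflexiveTransitive using (Star)
open import Relation.Binary.PropositionalEquality using (_≡_; _≢_)
open import Relation.Nullary using (¬_)
open import Relation.Nullary.Decidable using (_×-dec_; ¬?)
open import Relation.Unary using (Pred) renaming (Decidable to Decidable₁)

private
  variable
    n : ℕ

record Graph (n : ℕ) : Set₁ where
  field
    Adj        : Rel (Fin n) 0ℓ
    adj?       : Decidable Adj
    adj-sym    : Symmetric Adj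
    adj-irrefl : ∀ x → ¬ Adj x x

open Graph public

Connected : Graph n → Set
Connected G = ∀ x y → Star (Adj G) x y

-- punchIn v enumerates the vertices other than v, so this is the induced
-- subgraph on them, i.e. G − v with its vertices renumbered in order.
infixl 6 _∖_
_∖_ : Graph n → Fin n → Graph (pred n)
_∖_ {suc _} G v = record
  { Adj        = λ x y → Adj G (punchIn v x) (punchIn v y)
  ; adj?       = λ x y → adj? G (punchIn v x) (punchIn v y)
  ; adj-sym    = adj-sym G
  ; adj-irrefl = λ x → adj-irrefl G (punchIn v x)
  }

count : {P : Pred (Fin n) 0ℓ} → Decidable₁ P → ℕ
count P? = length (filter P? (allFin _))

module _ (G : Graph n) (x y : Fin n) where

  CommonNbr : Pred (Fin n) 0ℓ
  CommonNbr w = Adj G w x × Adj G w y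

  commonNbr? : Decidable₁ CommonNbr
  commonNbr? w = adj? G w x ×-dec adj? G w y

  PrivateNbr : Pred (Fin n) 0ℓ
  PrivateNbr w = w ≢ y × Adj G w x × ¬ Adj G w y

  privateNbr? : Decidable₁ PrivateNbr
  privateNbr? w = ¬? (w ≟ᶠ y) ×-dec adj? G w x ×-dec ¬? (adj? G w y)

module _ (G : Graph n) (k₁ k₂ k₃ : ℕ) where

  HasType : Pred (Fin n × Fin n) 0ℓ
  HasType (x , y) = Adj G x y
    × count (commonNbr? G x y) ≡ k₁
    × count (privateNbr? G x y) ≡ k₂
    × count (privateNbr? G y x) ≡ k₃

  hasType? : Decidable₁ HasType
  hasType? (x , y) = adj? G x y
    ×-dec (count (commonNbr? G x y) ≟ k₁)
    ×-dec (count (privateNbr? G x y) ≟ k₂)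
    ×-dec (count (privateNbr? G y x) ≟ k₃)

  -- Pairs are ordered, since x and y play different roles.  For k₂ ≢ k₃ this
  -- equals the number of unordered pairs admitting such a labelling; for
  -- k₂ ≡ k₃ it is twice that number.
  dav : ℕ
  dav = length (filter hasType? (cartesianProduct (allFin n) (allFin n)))

{-# OPTIONS --safe #-}
-- Fix an ordered adjacent pair (x , y) with C common neighbours and P, Q private
-- neighbours of x and of y.  Deleting a vertex v ∉ {x , y} lowers by one exactly
-- one of C, P, Q, or none of them, according to the kind of v.  Hence the pair has
-- type (k₁ , k₂ , k₃) in G − v for C of the v if its type in G is (k₁ + 1 , k₂ , k₃),
-- for P or Q of them in the two analogous cases, and for the n − 2 − C − P − Q
-- vertices adjacent to neither if its type in G is already (k₁ , k₂ , k₃).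
-- Summing over all pairs gives the identity; it is first proved in ℕ with the
-- negative terms moved to the left.
module Submission where

open import Data.List using (allFin; map)
open import Data.Nat using (ℕ; suc)
open import Data.Nat.ListAction using (sum)
open import Relation.Binary.PropositionalEquality using (_≡_; _≢_)
open import Defs

import Data.Integer.Properties as ℤ
import Data.Integer.Tactic.RingSolver as ℤSolver
import Data.Nat as ℕ
import Data.Nat.Properties as ℕ
open import Algebra.Properties.Semiring.Sum ℕ.+-*-semiring using (∑-comm; sum-cong-≗; sum-remove; sum-replicate-zero) renaming (sum to ∑)
open import Data.Bool using (if_then_else_; true; false)
open import Data.Fin using (Fin; zero; suc; punchIn)
open import Data.Fin.Properties using (punchIn-injective; punchInᵢ≢i; _≟_)
open import Data.List using (_++_; cartesianProduct; filter; length; tabulate)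
open import Data.List.Properties using (filter-++; length-++; map-tabulate)
open import Data.Nat.Tactic.RingSolver using (solve-∀)
open import Data.Product using (_×_; _,_)
open import Function using (_∘_; id; _⇔_; mk⇔)
open import Level using (0ℓ)
open import Relation.Binary.PropositionalEquality using (refl; sym; trans; cong; cong₂; module ≡-Reasoning)
open import Relation.Nullary using (Dec; does; yes; no; ¬_; contradiction)
open import Relation.Nullary.Decidable using (_×-dec_; ¬?; dec-false; dec-true; does-⇔)
open import Relation.Unary using (Pred) renaming (Decidable to Decidable₁)

open ≡-Reasoning

private
  variable
    m n : ℕ
    A B : Set

-- Indicators of decidable propositions

⟦_⟧ : Dec A → ℕ
⟦ a? ⟧ = if does a? then 1 else 0

⟦⟧-cong : A ⇔ B → (a? : Dec A) (b? : Dec B) → ⟦ a? ⟧ ≡ ⟦ b? ⟧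
⟦⟧-cong A⇔B a? b? = cong (if_then 1 else 0) (does-⇔ A⇔B a? b?)

⟦⟧-true : (a? : Dec A) → A → ⟦ a? ⟧ ≡ 1
⟦⟧-true a? a = cong (if_then 1 else 0) (dec-true a? a)

⟦⟧-false : (a? : Dec A) → ¬ A → ⟦ a? ⟧ ≡ 0
⟦⟧-false a? ¬a = cong (if_then 1 else 0) (dec-false a? ¬a)

-- A zero indicator annihilates both factors, so they need only agree when the proposition holds.
-- This lets a neighbour count be exchanged for the value prescribed by the type of a pair.
*-⟦⟧-cong : ∀ {j k} (a? : Dec A) → (A → j ≡ k) → j ℕ.* ⟦ a? ⟧ ≡ k ℕ.* ⟦ a? ⟧
*-⟦⟧-cong (yes a) j≡k = cong (ℕ._* 1) (j≡k a)
*-⟦⟧-cong {j = j} {k} (no _) _ = trans (ℕ.*-zeroʳ j) (sym (ℕ.*-zeroʳ k))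

-- Finite sums

sum-tabulate : (f : Fin n → ℕ) → sum (tabulate f) ≡ ∑ f
sum-tabulate {ℕ.zero} f = refl
sum-tabulate {suc n}  f = cong (f zero ℕ.+_) (sum-tabulate (f ∘ suc))

length-filter-tabulate : {P : Pred A 0ℓ} (P? : Decidable₁ P) (f : Fin n → A) →
  length (filter P? (tabulate f)) ≡ ∑ (λ i → ⟦ P? (f i) ⟧)
length-filter-tabulate {n = ℕ.zero} P? f = refl
length-filter-tabulate {n = suc n}  P? f with does (P? (f zero))
... | true  = cong suc (length-filter-tabulate P? (f ∘ suc))
... | false = length-filter-tabulate P? (f ∘ suc)

length-filter-cartesianProduct : {P : Pred (A × B) 0ℓ} (P? : Decidable₁ P)
  (f : Fin m → A) (g : Fin n → B) →
  length (filter P? (cartesianProduct (tabulate f) (tabulate g)))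
    ≡ ∑ (λ i → ∑ (λ j → ⟦ P? (f i , g j) ⟧))
length-filter-cartesianProduct {m = ℕ.zero} P? f g = refl
length-filter-cartesianProduct {m = suc m}  P? f g = begin
  length (filter P? (row ++ rest))
    ≡⟨ cong length (filter-++ P? row rest) ⟩
  length (filter P? row ++ filter P? rest)
    ≡⟨ length-++ (filter P? row) ⟩
  length (filter P? row) ℕ.+ length (filter P? rest)
    ≡⟨ cong₂ ℕ._+_
         (trans (cong (length ∘ filter P?) (map-tabulate g (f zero ,_)))
                (length-filter-tabulate P? (λ j → f zero , g j)))
         (length-filter-cartesianProduct P? (f ∘ suc) g) ⟩
  ∑ (λ i → ∑ (λ j → ⟦ P? (f i , g j) ⟧)) ∎
  where
  row  = map (f zero ,_) (tabulate g)
  rest = cartesianProduct (tabulate (f ∘ suc)) (tabulate g)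

count≡∑ : {P : Pred (Fin n) 0ℓ} (P? : Decidable₁ P) → count P? ≡ ∑ (λ i → ⟦ P? i ⟧)
count≡∑ P? = length-filter-tabulate P? id

dav≡∑ : (G : Graph n) (k₁ k₂ k₃ : ℕ) →
  dav G k₁ k₂ k₃ ≡ ∑ (λ x → ∑ (λ y → ⟦ hasType? G k₁ k₂ k₃ (x , y) ⟧))
dav≡∑ G k₁ k₂ k₃ = length-filter-cartesianProduct (hasType? G k₁ k₂ k₃) id id

∑-zero : (f : Fin n → ℕ) → (∀ i → f i ≡ 0) → ∑ f ≡ 0
∑-zero {n} f f≡0 = trans (sum-cong-≗ f≡0) (sum-replicate-zero n)

∑-punchIn : (i : Fin (suc n)) (f : Fin (suc n) → ℕ) → f i ≡ 0 → ∑ f ≡ ∑ (f ∘ punchIn i)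
∑-punchIn i f fi≡0 = trans (sum-remove {i = i} f) (cong (ℕ._+ ∑ (f ∘ punchIn i)) fi≡0)

-- Applied to each endpoint of a pair, this produces the 2 in the coefficient
-- `n - 2 - k₁ - k₂ - k₃`.
∑-≟ : (i : Fin (suc n)) → ∑ (λ j → ⟦ j ≟ i ⟧) ≡ 1
∑-≟ i = trans (sum-remove {i = i} (λ j → ⟦ j ≟ i ⟧))
  (cong₂ ℕ._+_ (⟦⟧-true (i ≟ i) refl)
               (∑-zero _ λ j → ⟦⟧-false (punchIn i j ≟ i) (punchInᵢ≢i i j)))

module _ where
  open import Data.Nat using (_+_; _*_)

  -- Constant coefficients pass through a sum. Two applications carry the balance of a single pair
  -- to all ordered pairs.
  ∑-linear : (f a b c d : Fin n → ℕ) (w p q r s : ℕ) →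
    (∀ i → f i + w * a i ≡ p * a i + q * b i + r * c i + s * d i) →
    ∑ f + w * ∑ a ≡ p * ∑ a + q * ∑ b + r * ∑ c + s * ∑ d
  ∑-linear {ℕ.zero} f a b c d w p q r s eq = zeros w p q r s
    where
    zeros : ∀ w p q r s → 0 + w * 0 ≡ p * 0 + q * 0 + r * 0 + s * 0
    zeros = solve-∀
  ∑-linear {suc n} f a b c d w p q r s eq = begin
    (f zero + ∑ (f ∘ suc)) + w * (a zero + ∑ (a ∘ suc))
      ≡⟨ left w (f zero) _ (a zero) _ ⟩
    (f zero + w * a zero) + (∑ (f ∘ suc) + w * ∑ (a ∘ suc))
      ≡⟨ cong₂ _+_ (eq zero) (∑-linear (f ∘ suc) (a ∘ suc) (b ∘ suc) (c ∘ suc) (d ∘ suc) w p q r s (eq ∘ suc)) ⟩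
    _ ≡⟨ right p q r s (a zero) (b zero) (c zero) (d zero) _ _ _ _ ⟩
    _ ∎
    where
    left : ∀ w f F a A → (f + F) + w * (a + A) ≡ (f + w * a) + (F + w * A)
    left = solve-∀
    right : ∀ p q r s a b c d A B C D →
      (p * a + q * b + r * c + s * d) + (p * A + q * B + r * C + s * D)
        ≡ p * (a + A) + q * (b + B) + r * (c + C) + s * (d + D)
    right = solve-∀

  -- The counterpart for summing over the deleted vertex with the pair fixed: the coefficients vary
  -- with the index, while `t`, `u`, `v`, `w` are type indicators of the pair and stay constant.
  ∑-linear-coeff : (f e₁ e₂ c p q : Fin n → ℕ) (t u v w : ℕ) →
    (∀ i → f i + (e₁ i + e₂ i + c i + p i + q i) * t ≡ t + c i * u + p i * v + q i * w) →
    ∑ f + (∑ e₁ + ∑ e₂ + ∑ c + ∑ p + ∑ q) * t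
      ≡ n * t + ∑ c * u + ∑ p * v + ∑ q * w
  ∑-linear-coeff {ℕ.zero} f e₁ e₂ c p q t u v w eq = refl
  ∑-linear-coeff {suc n} f e₁ e₂ c p q t u v w eq = begin
    _ ≡⟨ left (f zero) (e₁ zero) (e₂ zero) (c zero) (p zero) (q zero) _ _ _ _ _ _ t ⟩
    _ ≡⟨ cong₂ _+_ (eq zero) (∑-linear-coeff (f ∘ suc) (e₁ ∘ suc) (e₂ ∘ suc) (c ∘ suc) (p ∘ suc) (q ∘ suc) t u v w (eq ∘ suc)) ⟩
    _ ≡⟨ right (c zero) (p zero) (q zero) _ _ _ (n * t) t u v w ⟩
    _ ∎
    where
    left : ∀ f e₁ e₂ c p q F E₁ E₂ C P Q t →
      (f + F) + ((e₁ + E₁) + (e₂ + E₂) + (c + C) + (p + P) + (q + Q)) * t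
        ≡ (f + (e₁ + e₂ + c + p + q) * t) + (F + (E₁ + E₂ + C + P + Q) * t)
    left = solve-∀
    right : ∀ c p q C P Q N t u v w →
      (t + c * u + p * v + q * w) + (N + C * u + P * v + Q * w)
        ≡ (t + N) + (c + C) * u + (p + P) * v + (q + Q) * w
    right = solve-∀

-- Types of pairs in vertex-deleted subgraphs

module _ (G : Graph (suc m)) (v : Fin (suc m)) (x y : Fin m) where

  private
    x′ = punchIn v x
    y′ = punchIn v y

  count-commonNbr-∖ : count (commonNbr? G x′ y′)
    ≡ ⟦ commonNbr? G x′ y′ v ⟧ ℕ.+ count (commonNbr? (G ∖ v) x y)
  count-commonNbr-∖ = begin
    count (commonNbr? G x′ y′)
      ≡⟨ count≡∑ (commonNbr? G x′ y′) ⟩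
    ∑ (λ w → ⟦ commonNbr? G x′ y′ w ⟧)
      ≡⟨ sum-remove {i = v} (λ w → ⟦ commonNbr? G x′ y′ w ⟧) ⟩
    ⟦ commonNbr? G x′ y′ v ⟧ ℕ.+ ∑ (λ w → ⟦ commonNbr? G x′ y′ (punchIn v w) ⟧)
      ≡⟨ cong (⟦ commonNbr? G x′ y′ v ⟧ ℕ.+_) (count≡∑ (commonNbr? (G ∖ v) x y)) ⟨
    ⟦ commonNbr? G x′ y′ v ⟧ ℕ.+ count (commonNbr? (G ∖ v) x y) ∎

  count-privateNbr-∖ : count (privateNbr? G x′ y′)
    ≡ ⟦ privateNbr? G x′ y′ v ⟧ ℕ.+ count (privateNbr? (G ∖ v) x y)
  count-privateNbr-∖ = begin
    count (privateNbr? G x′ y′)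
      ≡⟨ count≡∑ (privateNbr? G x′ y′) ⟩
    ∑ (λ w → ⟦ privateNbr? G x′ y′ w ⟧)
      ≡⟨ sum-remove {i = v} (λ w → ⟦ privateNbr? G x′ y′ w ⟧) ⟩
    ⟦ privateNbr? G x′ y′ v ⟧ ℕ.+ ∑ (λ w → ⟦ privateNbr? G x′ y′ (punchIn v w) ⟧)
      -- Adjacency restricts definitionally, but the condition `w ≢ y` is transported by injectivity
      -- of `punchIn v`.
      ≡⟨ cong (⟦ privateNbr? G x′ y′ v ⟧ ℕ.+_) (sum-cong-≗ λ w →
           ⟦⟧-cong (private⇔ w) (privateNbr? G x′ y′ (punchIn v w)) (privateNbr? (G ∖ v) x y w)) ⟩
    ⟦ privateNbr? G x′ y′ v ⟧ ℕ.+ ∑ (λ w → ⟦ privateNbr? (G ∖ v) x y w ⟧)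
      ≡⟨ cong (⟦ privateNbr? G x′ y′ v ⟧ ℕ.+_) (count≡∑ (privateNbr? (G ∖ v) x y)) ⟨
    ⟦ privateNbr? G x′ y′ v ⟧ ℕ.+ count (privateNbr? (G ∖ v) x y) ∎
    where
    private⇔ : ∀ w → PrivateNbr G x′ y′ (punchIn v w) ⇔ PrivateNbr (G ∖ v) x y w
    private⇔ w = mk⇔
      (λ (w≢y , adj) → w≢y ∘ cong (punchIn v) , adj)
      (λ (w≢y , adj) → w≢y ∘ punchIn-injective v w y , adj)

module _ (G : Graph n) (x y : Fin n) (k₁ k₂ k₃ : ℕ) where

  -- The numerical part of `HasType`, split off because the indicator of `hasType?` reduces to that
  -- of `hasCounts?` once the pair is known to be adjacent.
  HasCounts : Set
  HasCounts = count (commonNbr? G x y) ≡ k₁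
    × count (privateNbr? G x y) ≡ k₂
    × count (privateNbr? G y x) ≡ k₃

  hasCounts? : Dec HasCounts
  hasCounts? = (count (commonNbr? G x y) ℕ.≟ k₁)
    ×-dec (count (privateNbr? G x y) ℕ.≟ k₂)
    ×-dec (count (privateNbr? G y x) ℕ.≟ k₃)

module _ (G : Graph n) (k₁ k₂ k₃ : ℕ) (v : Fin n) where

  -- The pair (x , y) avoids v and has type (k₁ , k₂ , k₃) in G − v, expressed
  -- without renumbering the vertices.
  HasTypeWithout : Pred (Fin n × Fin n) 0ℓ
  HasTypeWithout (x , y) = Adj G x y × v ≢ x × v ≢ y
    × HasCounts G x y (⟦ commonNbr? G x y v ⟧ ℕ.+ k₁)
        (⟦ privateNbr? G x y v ⟧ ℕ.+ k₂) (⟦ privateNbr? G y x v ⟧ ℕ.+ k₃)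

  hasTypeWithout? : Decidable₁ HasTypeWithout
  hasTypeWithout? (x , y) = adj? G x y ×-dec ¬? (v ≟ x) ×-dec ¬? (v ≟ y)
    ×-dec hasCounts? G x y (⟦ commonNbr? G x y v ⟧ ℕ.+ k₁)
            (⟦ privateNbr? G x y v ⟧ ℕ.+ k₂) (⟦ privateNbr? G y x v ⟧ ℕ.+ k₃)

hasTypeWithout⇔hasType-∖ : (G : Graph (suc m)) (k₁ k₂ k₃ : ℕ) (v : Fin (suc m)) (x y : Fin m) →
  HasTypeWithout G k₁ k₂ k₃ v (punchIn v x , punchIn v y) ⇔ HasType (G ∖ v) k₁ k₂ k₃ (x , y)
hasTypeWithout⇔hasType-∖ G k₁ k₂ k₃ v x y = mk⇔
  (λ (adj , _ , _ , c , p , q) → adj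
    , ℕ.+-cancelˡ-≡ _ _ _ (trans (sym (count-commonNbr-∖ G v x y)) c)
    , ℕ.+-cancelˡ-≡ _ _ _ (trans (sym (count-privateNbr-∖ G v x y)) p)
    , ℕ.+-cancelˡ-≡ _ _ _ (trans (sym (count-privateNbr-∖ G v y x)) q))
  (λ (adj , c , p , q) → adj
    , punchInᵢ≢i v x ∘ sym
    , punchInᵢ≢i v y ∘ sym
    , trans (count-commonNbr-∖ G v x y) (cong (_ ℕ.+_) c)
    , trans (count-privateNbr-∖ G v x y) (cong (_ ℕ.+_) p)
    , trans (count-privateNbr-∖ G v y x) (cong (_ ℕ.+_) q))

-- Pairs containing `v` contribute zero to `hasTypeWithout?`, so the sums may run over all vertices
-- of `G`. Their ranges then no longer depend on `v`, and the sums can be interchanged.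
dav-∖ : (G : Graph (suc m)) (k₁ k₂ k₃ : ℕ) (v : Fin (suc m)) →
  dav (G ∖ v) k₁ k₂ k₃ ≡ ∑ (λ x → ∑ (λ y → ⟦ hasTypeWithout? G k₁ k₂ k₃ v (x , y) ⟧))
dav-∖ G k₁ k₂ k₃ v = begin
  dav (G ∖ v) k₁ k₂ k₃
    ≡⟨ dav≡∑ (G ∖ v) k₁ k₂ k₃ ⟩
  ∑ (λ x → ∑ (λ y → ⟦ hasType? (G ∖ v) k₁ k₂ k₃ (x , y) ⟧))
    ≡⟨ sum-cong-≗ (λ x → sum-cong-≗ λ y →
         ⟦⟧-cong (hasTypeWithout⇔hasType-∖ G k₁ k₂ k₃ v x y)
           (without? (punchIn v x , punchIn v y)) (hasType? (G ∖ v) k₁ k₂ k₃ (x , y))) ⟨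
  ∑ (λ x → ∑ (λ y → ⟦ without? (punchIn v x , punchIn v y) ⟧))
    ≡⟨ sum-cong-≗ (λ x → ∑-punchIn v (λ y → ⟦ without? (punchIn v x , y) ⟧)
         (⟦⟧-false (without? (punchIn v x , v)) λ (_ , _ , v≢v , _) → v≢v refl)) ⟨
  ∑ (λ x → ∑ (λ y → ⟦ without? (punchIn v x , y) ⟧))
    ≡⟨ ∑-punchIn v (λ x → ∑ (λ y → ⟦ without? (x , y) ⟧))
         (∑-zero _ λ y → ⟦⟧-false (without? (v , y)) λ (_ , v≢v , _) → v≢v refl) ⟨
  ∑ (λ x → ∑ (λ y → ⟦ without? (x , y) ⟧)) ∎
  where without? = hasTypeWithout? G k₁ k₂ k₃ v

-- Effect of deleting one vertex on one ordered pair

module _ where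
  open import Data.Nat using (_+_; _*_)

  private
    unchanged : ∀ t → t + 0 ≡ t + 0 + 0 + 0
    unchanged = solve-∀

    common : ∀ t u → u + 1 * t ≡ t + 1 * u + 0 + 0
    common = solve-∀

    private-x : ∀ t u → u + 1 * t ≡ t + 0 + 1 * u + 0
    private-x = solve-∀

    private-y : ∀ t u → u + 1 * t ≡ t + 0 + 0 + 1 * u
    private-y = solve-∀

  hasTypeWithout-balance : (G : Graph n) (k₁ k₂ k₃ : ℕ) (x y v : Fin n) →
    ⟦ hasTypeWithout? G k₁ k₂ k₃ v (x , y) ⟧
      + (⟦ v ≟ x ⟧ + ⟦ v ≟ y ⟧ + ⟦ commonNbr? G x y v ⟧ + ⟦ privateNbr? G x y v ⟧ + ⟦ privateNbr? G y x v ⟧)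
        * ⟦ hasType? G k₁ k₂ k₃ (x , y) ⟧
    ≡ ⟦ hasType? G k₁ k₂ k₃ (x , y) ⟧
      + ⟦ commonNbr? G x y v ⟧ * ⟦ hasType? G (suc k₁) k₂ k₃ (x , y) ⟧
      + ⟦ privateNbr? G x y v ⟧ * ⟦ hasType? G k₁ (suc k₂) k₃ (x , y) ⟧
      + ⟦ privateNbr? G y x v ⟧ * ⟦ hasType? G k₁ k₂ (suc k₃) (x , y) ⟧
  hasTypeWithout-balance G k₁ k₂ k₃ x y v with adj? G x y | v ≟ x | v ≟ y | adj? G v x | adj? G v y
  -- All type indicators of a non-adjacent pair vanish, whatever the coefficients.
  ... | no _     | v≟x      | v≟y      | v~x     | v~y     =
    trans (ℕ.*-zeroʳ (⟦ v≟x ⟧ + ⟦ v≟y ⟧ + c + p + q))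
      (sym (cong₂ _+_ (cong₂ _+_ (ℕ.*-zeroʳ c) (ℕ.*-zeroʳ p)) (ℕ.*-zeroʳ q)))
    where
    c = ⟦ v~x ×-dec v~y ⟧
    p = ⟦ ¬? v≟y ×-dec v~x ×-dec ¬? v~y ⟧
    q = ⟦ ¬? v≟x ×-dec v~y ×-dec ¬? v~x ⟧
  ... | yes x~x  | yes refl | yes refl | _       | _       = contradiction x~x (adj-irrefl G v)
  ... | yes _    | yes refl | no _     | yes x~x | _       = contradiction x~x (adj-irrefl G v)
  ... | yes _    | no _     | yes refl | _       | yes y~y = contradiction y~y (adj-irrefl G v)
  -- If `v` is an endpoint, the pair is destroyed and the endpoint indicator supplies the missing
  -- `t`; the clause `w ≢ y` of `PrivateNbr` keeps `v` from being counted as private too. If `v` is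
  -- neither an endpoint nor a neighbour, the type is unaffected. Both situations reduce to one
  -- identity.
  ... | yes _    | yes refl | no _     | no _    | no _    = unchanged ⟦ hasCounts? G x y k₁ k₂ k₃ ⟧
  ... | yes _    | yes refl | no _     | no _    | yes _   = unchanged ⟦ hasCounts? G x y k₁ k₂ k₃ ⟧
  ... | yes _    | no _     | yes refl | no _    | no _    = unchanged ⟦ hasCounts? G x y k₁ k₂ k₃ ⟧
  ... | yes _    | no _     | yes refl | yes _   | no _    = unchanged ⟦ hasCounts? G x y k₁ k₂ k₃ ⟧
  ... | yes _    | no _     | no _     | no _    | no _    = unchanged ⟦ hasCounts? G x y k₁ k₂ k₃ ⟧
  -- From here on exactly one neighbour indicator is 1. It raises the matching count required in `G`
  -- by one, and its multiple of `t` on the left cancels the `t` on the right.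
  ... | yes _    | no _     | no _     | yes _   | yes _   =
    common ⟦ hasCounts? G x y k₁ k₂ k₃ ⟧ ⟦ hasCounts? G x y (suc k₁) k₂ k₃ ⟧
  ... | yes _    | no _     | no _     | yes _   | no _    =
    private-x ⟦ hasCounts? G x y k₁ k₂ k₃ ⟧ ⟦ hasCounts? G x y k₁ (suc k₂) k₃ ⟧
  ... | yes _    | no _     | no _     | no _    | yes _   =
    private-y ⟦ hasCounts? G x y k₁ k₂ k₃ ⟧ ⟦ hasCounts? G x y k₁ k₂ (suc k₃) ⟧

-- Summation over deleted vertices and pairs

davs-∖-balance : (G : Graph (suc m)) (k₁ k₂ k₃ : ℕ) →
  sum (map (λ v → dav (G ∖ v) k₁ k₂ k₃) (allFin (suc m))) ℕ.+ (2 ℕ.+ k₁ ℕ.+ k₂ ℕ.+ k₃) ℕ.* dav G k₁ k₂ k₃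
    ≡ suc m ℕ.* dav G k₁ k₂ k₃
      ℕ.+ suc k₁ ℕ.* dav G (suc k₁) k₂ k₃
      ℕ.+ suc k₂ ℕ.* dav G k₁ (suc k₂) k₃
      ℕ.+ suc k₃ ℕ.* dav G k₁ k₂ (suc k₃)
davs-∖-balance {m} G k₁ k₂ k₃
  rewrite dav≡∑ G k₁ k₂ k₃ | dav≡∑ G (suc k₁) k₂ k₃ | dav≡∑ G k₁ (suc k₂) k₃ | dav≡∑ G k₁ k₂ (suc k₃)
  = trans (cong (ℕ._+ w ℕ.* ∑ (λ x → ∑ (type k₁ k₂ k₃ x))) davs≡∑)
      (∑-linear (λ x → ∑ (λ y → ∑ (λ v → without v x y)))
        (∑ ∘ type k₁ k₂ k₃) (∑ ∘ type (suc k₁) k₂ k₃) (∑ ∘ type k₁ (suc k₂) k₃) (∑ ∘ type k₁ k₂ (suc k₃))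
        w (suc m) (suc k₁) (suc k₂) (suc k₃) λ x →
          ∑-linear (λ y → ∑ (λ v → without v x y))
            (type k₁ k₂ k₃ x) (type (suc k₁) k₂ k₃ x) (type k₁ (suc k₂) k₃ x) (type k₁ k₂ (suc k₃) x)
            w (suc m) (suc k₁) (suc k₂) (suc k₃) (pair-balance x))
  where
  w = 2 ℕ.+ k₁ ℕ.+ k₂ ℕ.+ k₃

  without : Fin (suc m) → Fin (suc m) → Fin (suc m) → ℕ
  without v x y = ⟦ hasTypeWithout? G k₁ k₂ k₃ v (x , y) ⟧

  type : ℕ → ℕ → ℕ → Fin (suc m) → Fin (suc m) → ℕ
  type i j l x y = ⟦ hasType? G i j l (x , y) ⟧

  davs≡∑ : sum (map (λ v → dav (G ∖ v) k₁ k₂ k₃) (allFin (suc m)))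
    ≡ ∑ (λ x → ∑ (λ y → ∑ (λ v → without v x y)))
  davs≡∑ = begin
    sum (map (λ v → dav (G ∖ v) k₁ k₂ k₃) (allFin (suc m)))
      ≡⟨ cong sum (map-tabulate id (λ v → dav (G ∖ v) k₁ k₂ k₃)) ⟩
    sum (tabulate (λ v → dav (G ∖ v) k₁ k₂ k₃))
      ≡⟨ sum-tabulate (λ v → dav (G ∖ v) k₁ k₂ k₃) ⟩
    ∑ (λ v → dav (G ∖ v) k₁ k₂ k₃)
      ≡⟨ sum-cong-≗ (dav-∖ G k₁ k₂ k₃) ⟩
    ∑ (λ v → ∑ (λ x → ∑ (λ y → without v x y)))
      ≡⟨ ∑-comm (λ v x → ∑ (λ y → without v x y)) ⟩
    ∑ (λ x → ∑ (λ v → ∑ (λ y → without v x y)))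
      ≡⟨ sum-cong-≗ (λ x → ∑-comm (λ v y → without v x y)) ⟩
    ∑ (λ x → ∑ (λ y → ∑ (λ v → without v x y))) ∎

  pair-balance : ∀ x y →
    ∑ (λ v → without v x y) ℕ.+ w ℕ.* type k₁ k₂ k₃ x y
      ≡ suc m ℕ.* type k₁ k₂ k₃ x y
        ℕ.+ suc k₁ ℕ.* type (suc k₁) k₂ k₃ x y
        ℕ.+ suc k₂ ℕ.* type k₁ (suc k₂) k₃ x y
        ℕ.+ suc k₃ ℕ.* type k₁ k₂ (suc k₃) x y
  pair-balance x y = begin
    ∑ (λ v → without v x y) ℕ.+ w ℕ.* type k₁ k₂ k₃ x y
      -- Where the indicator of type `(k₁ , k₂ , k₃)` is nonzero, the three counts are the `kᵢ`, so
      -- `w` splits into five sums over `v`.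
      ≡⟨ cong (∑ (λ v → without v x y) ℕ.+_) (*-⟦⟧-cong (hasType? G k₁ k₂ k₃ (x , y)) λ (_ , c , p , q) →
           cong₂ ℕ._+_ (cong₂ ℕ._+_ (cong₂ ℕ._+_ (cong₂ ℕ._+_ (∑-≟ x) (∑-≟ y))
             (trans (sym ∑C) c)) (trans (sym ∑P) p)) (trans (sym ∑Q) q)) ⟨
    ∑ (λ v → without v x y) ℕ.+ (∑ (λ v → ⟦ v ≟ x ⟧) ℕ.+ ∑ (λ v → ⟦ v ≟ y ⟧) ℕ.+ ∑ C ℕ.+ ∑ P ℕ.+ ∑ Q) ℕ.* type k₁ k₂ k₃ x y
      ≡⟨ ∑-linear-coeff (λ v → without v x y) (λ v → ⟦ v ≟ x ⟧) (λ v → ⟦ v ≟ y ⟧) C P Q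
           (type k₁ k₂ k₃ x y) (type (suc k₁) k₂ k₃ x y) (type k₁ (suc k₂) k₃ x y) (type k₁ k₂ (suc k₃) x y)
           (hasTypeWithout-balance G k₁ k₂ k₃ x y) ⟩
    suc m ℕ.* type k₁ k₂ k₃ x y
      ℕ.+ ∑ C ℕ.* type (suc k₁) k₂ k₃ x y
      ℕ.+ ∑ P ℕ.* type k₁ (suc k₂) k₃ x y
      ℕ.+ ∑ Q ℕ.* type k₁ k₂ (suc k₃) x y
      -- Each count multiplies the indicator of a type in which that count is raised, hence the
      -- factors `suc kᵢ`.
      ≡⟨ cong₂ ℕ._+_ (cong₂ ℕ._+_ (cong (suc m ℕ.* type k₁ k₂ k₃ x y ℕ.+_)
           (*-⟦⟧-cong (hasType? G (suc k₁) k₂ k₃ (x , y)) λ (_ , c , _ , _) → trans (sym ∑C) c))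
           (*-⟦⟧-cong (hasType? G k₁ (suc k₂) k₃ (x , y)) λ (_ , _ , p , _) → trans (sym ∑P) p))
           (*-⟦⟧-cong (hasType? G k₁ k₂ (suc k₃) (x , y)) λ (_ , _ , _ , q) → trans (sym ∑Q) q) ⟩
    suc m ℕ.* type k₁ k₂ k₃ x y
      ℕ.+ suc k₁ ℕ.* type (suc k₁) k₂ k₃ x y
      ℕ.+ suc k₂ ℕ.* type k₁ (suc k₂) k₃ x y
      ℕ.+ suc k₃ ℕ.* type k₁ k₂ (suc k₃) x y ∎
    where
    C P Q : Fin (suc m) → ℕ
    C v = ⟦ commonNbr? G x y v ⟧
    P v = ⟦ privateNbr? G x y v ⟧
    Q v = ⟦ privateNbr? G y x v ⟧
    ∑C = count≡∑ (commonNbr? G x y)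
    ∑P = count≡∑ (privateNbr? G x y)
    ∑Q = count≡∑ (privateNbr? G y x)

-- Transfer to the integers

open import Data.Integer using (+_; _+_; _-_; _*_)

balance⇒ℤ : ∀ S n k₁ k₂ k₃ D a b c →
  S ℕ.+ (2 ℕ.+ k₁ ℕ.+ k₂ ℕ.+ k₃) ℕ.* D ≡ n ℕ.* D ℕ.+ a ℕ.+ b ℕ.+ c →
  + S ≡ (+ n - + 2 - + k₁ - + k₂ - + k₃) * + D + + a + + b + + c
balance⇒ℤ S n k₁ k₂ k₃ D a b c eq = begin
  + S
    ≡⟨ add-sub (+ S) (+ k₁) (+ k₂) (+ k₃) (+ D) ⟩
  + S + (+ 2 + + k₁ + + k₂ + + k₃) * + D - (+ 2 + + k₁ + + k₂ + + k₃) * + D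
    ≡⟨ cong (_- (+ 2 + + k₁ + + k₂ + + k₃) * + D) eqℤ ⟩
  + n * + D + + a + + b + + c - (+ 2 + + k₁ + + k₂ + + k₃) * + D
    ≡⟨ collect (+ n) (+ k₁) (+ k₂) (+ k₃) (+ D) (+ a) (+ b) (+ c) ⟩
  (+ n - + 2 - + k₁ - + k₂ - + k₃) * + D + + a + + b + + c ∎
  where
  add-sub : ∀ S k₁ k₂ k₃ D →
    S ≡ S + (+ 2 + k₁ + k₂ + k₃) * D - (+ 2 + k₁ + k₂ + k₃) * D
  add-sub = ℤSolver.solve-∀
  collect : ∀ n k₁ k₂ k₃ D a b c →
    n * D + a + b + c - (+ 2 + k₁ + k₂ + k₃) * D ≡ (n - + 2 - k₁ - k₂ - k₃) * D + a + b + c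
  collect = ℤSolver.solve-∀
  eqℤ : + S + (+ 2 + + k₁ + + k₂ + + k₃) * + D ≡ + n * + D + + a + + b + + c
  eqℤ = begin
    + S + + (2 ℕ.+ k₁ ℕ.+ k₂ ℕ.+ k₃) * + D
      ≡⟨ cong (λ z → + S + z) (ℤ.pos-* (2 ℕ.+ k₁ ℕ.+ k₂ ℕ.+ k₃) D) ⟨
    + (S ℕ.+ (2 ℕ.+ k₁ ℕ.+ k₂ ℕ.+ k₃) ℕ.* D)
      ≡⟨ cong +_ eq ⟩
    + (n ℕ.* D) + + a + + b + + c
      ≡⟨ cong (λ z → z + + a + + b + + c) (ℤ.pos-* n D) ⟩
    + n * + D + + a + + b + + c ∎

theorem16 : ∀ (n : ℕ) (G : Graph n) → Connected G →
    ∀ (k₁ k₂ k₃ : ℕ) → k₂ ≢ k₃ →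
    + sum (map (λ v → dav (G ∖ v) k₁ k₂ k₃) (allFin n))
    ≡ (+ n - + 2 - + k₁ - + k₂ - + k₃) * + dav G k₁ k₂ k₃
    + + suc k₁ * + dav G (suc k₁) k₂ k₃
    + + suc k₂ * + dav G k₁ (suc k₂) k₃
    + + suc k₃ * + dav G k₁ k₂ (suc k₃)
-- With no vertices every `dav` evaluates to 0; the balance is available only for `suc m` vertices.
theorem16 ℕ.zero G _ k₁ k₂ k₃ _ = no-pairs (+ 0 - + 2 - + k₁ - + k₂ - + k₃) (+ suc k₁) (+ suc k₂) (+ suc k₃)
  where
  no-pairs : ∀ z a b c → + 0 ≡ z * + 0 + a * + 0 + b * + 0 + c * + 0
  no-pairs = ℤSolver.solve-∀
theorem16 (suc m) G _ k₁ k₂ k₃ _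
  -- The last three products are folded into casts of natural numbers, matching `a`, `b`, `c` in
  -- `balance⇒ℤ`.
  rewrite sym (ℤ.pos-* (suc k₁) (dav G (suc k₁) k₂ k₃))
        | sym (ℤ.pos-* (suc k₂) (dav G k₁ (suc k₂) k₃))
        | sym (ℤ.pos-* (suc k₃) (dav G k₁ k₂ (suc k₃)))
  = balance⇒ℤ _ (suc m) k₁ k₂ k₃ (dav G k₁ k₂ k₃) _ _ _ (davs-∖-balance G k₁ k₂ k₃)
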